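{- For every $n\geq 1$, $\gamma'_{MB}(P_2\square P_n)=n$.
   Context: $P_k$ is the path on $k$ vertices and $\square$ the Cartesian product, so $P_2\square P_n$ is the $2\times n$ grid. In the Maker–Breaker domination game on a graph $G$, two players, Dominator and Staller, alternately claim previously unclaimed vertices of $G$. Dominator wins if the set of vertices he claims becomes a dominating set of $G$ (every vertex not in it has a neighbour in it); Staller wins if she claims some vertex together with all of its neighbours. In the $S$-game Staller moves first. $\gamma'_{MB}(G)$ is the minimum number of moves Dominator needs to win the $S$-game on $G$ against optimal play by Staller (who tries to postpone his win). -}

module Defs where

open import Data.Nat using (ℕ; zero; suc; _<_)
open import Data.Fin using (Fin; toℕ)
open import Data.Product using (_×_; _,_; ∃; ∃-syntax)
open import Data.Sum using (_⊎_)
open import Data.Empty using (⊥)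
open import Relation.Nullary using (¬_)
open import Relation.Binary.PropositionalEquality using (_≡_)

record Graph : Set₁ where
  field
    Vertex : Set
    _~_    : Vertex → Vertex → Set
open Graph public

P : ℕ → Graph
P k = record
  { Vertex = Fin k
  ; _~_    = λ a b → (toℕ a ≡ suc (toℕ b)) ⊎ (toℕ b ≡ suc (toℕ a)) }

_□_ : Graph → Graph → Graph
G □ H = record
  { Vertex = Vertex G × Vertex H
  ; _~_    = λ { (g , h) (g' , h') →
                 (g ≡ g' × _~_ H h h') ⊎ (_~_ G g g' × h ≡ h') } }

VSet : Graph → Set₁
VSet G = Vertex G → Set

_⊕_ : {G : Graph} → VSet G → Vertex G → VSet G
(A ⊕ v) u = A u ⊎ u ≡ v

module Game (G : Graph) where
  V = Vertex G
  _∼_ = _~_ G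

  Dominating : VSet G → Set
  Dominating D = ∀ v → D v ⊎ (∃[ u ] (v ∼ u × D u))

  StallerWon : VSet G → Set
  StallerWon S = ∃[ v ] (S v × (∀ u → v ∼ u → S u))

  Unclaimed : VSet G → VSet G → V → Set
  Unclaimed D S v = ¬ D v × ¬ S v

  mutual
    -- Staller to move; current claims D (Dominator), S (Staller);
    -- Dominator can force a win using at most k further moves.
    WinS : ℕ → VSet G → VSet G → Set
    WinS k D S = Dominating D ⊎
      (∀ v → Unclaimed D S v → ¬ StallerWon (_⊕_ {G} S v) × WinD k D (_⊕_ {G} S v))

    -- Dominator to move; he can force a win using at most k further moves.
    WinD : ℕ → VSet G → VSet G → Set
    WinD zero    D S = Dominating D
    WinD (suc k) D S = Dominating D ⊎
      (∃[ u ] (Unclaimed D S u × WinS k (_⊕_ {G} D u) S))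

  ∅ : VSet G
  ∅ _ = ⊥

  WinsSGameWithin : ℕ → Set
  WinsSGameWithin k = WinS k ∅ ∅

γ'MB≡ : Graph → ℕ → Set
γ'MB≡ G m = Game.WinsSGameWithin G m × (∀ k → k < m → ¬ Game.WinsSGameWithin G k)

-- Dominator wins in n moves by answering every move of Staller in the same column.
--
-- Staller prevents anything faster by sweeping the columns from n - 1 down to 0 while Dominator
-- spends one move per column.  Let (a , c) be undominated, with only two free cells s and p left
-- around it in columns ≥ c, and let her take (a , c - 1).  If Dominator takes s or p, the same
-- situation recurs one column further.  If he takes a distant cell y instead, she forces him cell
-- by cell towards y: each forced reply also determines the next one, so the forced cells lie on
-- a line, and she picks a line running through y.  When the sweep reaches y, that cell has
-- replaced the reply in its own column and nothing was gained.

module Submission where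

open import Defs
open import Data.Bool using (if_then_else_)
open import Data.Fin as Fin using (Fin; zero; suc; toℕ; fromℕ<; opposite)
open import Data.Fin.Properties using (toℕ-fromℕ<; toℕ-injective; toℕ<n; opposite-involutive)
open import Data.Fin.Subset using (Subset; ∣_∣; _∈_; _∉_; _-_; ⁅_⁆)
open import Data.Fin.Subset.Properties
  using (_∈?_; ∈⊤; ∣⊤∣≡n; p─q⊆p; p─q─q≡p─q; x∈p⇒∣p-x∣<∣p∣; x∈p∧x≢y⇒x∈p-y)
open import Data.Maybe using (Maybe; just; nothing)
open import Data.Nat using (ℕ; zero; suc; _≥_; _≤_; _<_; z≤n; s≤s; 2+; s≤s⁻¹; _<?_)
open import Data.Nat.Properties as ℕₚ
  using (≤-refl; ≤-reflexive; ≤-trans; <-irrefl; <⇒≤; <⇒≱; m≤n⇒m<n∨m≡n; m≤n⇒m≤1+n; n≤1+n; n<1+n)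
open import Data.Product using (_×_; _,_; proj₁; proj₂; ∃-syntax)
open import Data.Product.Properties using (≡-dec)
open import Data.Sum using (_⊎_; inj₁; inj₂; [_,_]′; map; map₂; swap)
open import Function using (_∘_)
open import Relation.Binary.Definitions using (DecidableEquality)
open import Relation.Binary.PropositionalEquality
  using (_≡_; _≢_; refl; sym; trans; cong; subst; ≢-sym)
open import Relation.Nullary using (¬_; yes; no; does; contradiction)
open import Relation.Nullary.Decidable using (dec-true; dec-false; decidable-stable)

-- Cells of the strip and closed neighbourhoods

Row : Set
Row = Fin 2

-- Columns range over all of `ℕ`, so that every cell has a neighbour in the next column, also at the
-- end of the board.
Cell : Set
Cell = Row × ℕ

_≟_ : DecidableEquality Cell
_≟_ = ≡-dec Fin._≟_ ℕₚ._≟_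

col : Cell → ℕ
col = proj₂

row-dichotomy : ∀ {a b : Row} → a ≢ b → ∀ r → r ≡ a ⊎ r ≡ b
row-dichotomy {zero}     {zero}     a≢b _          = contradiction refl a≢b
row-dichotomy {suc zero} {suc zero} a≢b _          = contradiction refl a≢b
row-dichotomy {zero}     {suc zero} _   zero       = inj₁ refl
row-dichotomy {zero}     {suc zero} _   (suc zero) = inj₂ refl
row-dichotomy {suc zero} {zero}     _   zero       = inj₂ refl
row-dichotomy {suc zero} {zero}     _   (suc zero) = inj₁ refl

col<⇒≢ : ∀ {u v : Cell} → col u < col v → u ≢ v
col<⇒≢ lt refl = <-irrefl refl lt

row≢⇒≢ : ∀ {r r' : Row} {i j : ℕ} → r ≢ r' → (r , i) ≢ (r' , j)
row≢⇒≢ r≢r' refl = r≢r' refl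

data _∈N[_] : Cell → Cell → Set where
  self : ∀ {v} → v ∈N[ v ]
  flip : ∀ {r r' i} → r ≢ r' → (r' , i) ∈N[ r , i ]
  up   : ∀ {r i} → (r , suc i) ∈N[ r , i ]
  down : ∀ {r i} → (r , i) ∈N[ r , suc i ]

∈N-col : ∀ {u r i} → u ∈N[ r , suc i ] → i ≤ col u
∈N-col self     = n≤1+n _
∈N-col (flip _) = n≤1+n _
∈N-col up       = m≤n⇒m≤1+n (n≤1+n _)
∈N-col down     = ≤-refl

-- Positions with decidable ownership

data Player : Set where
  dominator staller : Player

pattern free = nothing
pattern dom  = just dominator
pattern stal = just staller

Position : Set
Position = Cell → Maybe Player

-- Opaque, so that unification recovers σ and u from σ at u.
opaque

  _at_ : Position → Cell → Maybe Player
  σ at u = σ u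

  _[_≔_] : Position → Cell → Player → Position
  (σ [ v ≔ A ]) u = if does (u ≟ v) then just A else σ u

  at-def : ∀ {σ u} → σ at u ≡ σ u
  at-def = refl

module _ {σ : Position} {v : Cell} {A : Player} where

  opaque
    unfolding _at_

    placed : (σ [ v ≔ A ]) at v ≡ just A
    placed rewrite dec-true (v ≟ v) refl = refl

    elsewhere : ∀ {u} → u ≢ v → (σ [ v ≔ A ]) at u ≡ σ at u
    elsewhere {u} u≢v rewrite dec-false (u ≟ v) u≢v = refl

  keep : ∀ {u m} → u ≢ v → σ at u ≡ m → (σ [ v ≔ A ]) at u ≡ m
  keep u≢v = trans (elsewhere u≢v)

  keep-claim : ∀ {u B} → σ at v ≡ free → σ at u ≡ just B → (σ [ v ≔ A ]) at u ≡ just B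
  keep-claim v-free u-B = keep (λ { refl → nothing≢just (trans (sym v-free) u-B) }) u-B
    where
    nothing≢just : ∀ {B : Player} → nothing ≢ just B
    nothing≢just ()

  unplace : ∀ {u m} → (σ [ v ≔ A ]) at u ≡ m → (u ≡ v × m ≡ just A) ⊎ (u ≢ v × σ at u ≡ m)
  unplace {u} eq with u ≟ v
  ... | yes refl = inj₁ (refl , trans (sym eq) placed)
  ... | no  u≢v  = inj₂ (u≢v , trans (sym (elsewhere u≢v)) eq)

  unplace-free : ∀ {u} → (σ [ v ≔ A ]) at u ≡ free → u ≢ v × σ at u ≡ free
  unplace-free eq with unplace eq
  ... | inj₂ r = r

  keep-undom : ∀ {u} → u ≢ v → σ at u ≢ dom → (σ [ v ≔ A ]) at u ≢ dom
  keep-undom u≢v u-undom = u-undom ∘ trans (sym (elsewhere u≢v))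

keep-undomˢ : ∀ {σ v u} → σ at u ≢ dom → (σ [ v ≔ staller ]) at u ≢ dom
keep-undomˢ u-undom eq with unplace eq
... | inj₂ (_ , u-dom) = u-undom u-dom

free⇒undom : ∀ {m : Maybe Player} → m ≡ free → m ≢ dom
free⇒undom refl ()

stal⇒undom : ∀ {m : Maybe Player} → m ≡ stal → m ≢ dom
stal⇒undom refl ()

stal⇒unfree : ∀ {m : Maybe Player} → m ≡ stal → m ≢ free
stal⇒unfree refl ()

dom⇒unfree : ∀ {m : Maybe Player} → m ≡ dom → m ≢ free
dom⇒unfree refl ()

settle : ∀ {m : Maybe Player} → m ≢ dom → m ≢ free → m ≡ stal
settle {free} _ ¬free = contradiction refl ¬free
settle {dom} ¬dom _ = contradiction refl ¬dom
settle {stal} _ _ = refl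

-- Threats and forced replies

module Staller (n : ℕ) where

  open Game (P 2 □ P n)

  cell : V → Cell
  cell (r , i) = r , toℕ i

  cell-injective : ∀ {u v} → cell u ≡ cell v → u ≡ v
  cell-injective {_ , i} {_ , j} eq with cong proj₁ eq | toℕ-injective {i = i} {j} (cong proj₂ eq)
  ... | refl | refl = refl

  ∼⇒∈N : ∀ {v u} → v ∼ u → cell u ∈N[ cell v ]
  ∼⇒∈N {r , i} {_ , j} (inj₁ (refl , inj₁ eq)) =
    subst (λ c → (r , toℕ j) ∈N[ r , c ]) (sym eq) down
  ∼⇒∈N {r , i} {_ , j} (inj₁ (refl , inj₂ eq)) =
    subst (λ c → (r , c) ∈N[ r , toℕ i ]) (sym eq) up
  ∼⇒∈N {r , i} {r' , _} (inj₂ (adj , refl)) = flip (λ { refl → irr adj })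
    where
    irr : ∀ {x : ℕ} → ¬ (x ≡ suc x ⊎ x ≡ suc x)
    irr (inj₁ ())
    irr (inj₂ ())

  -- Outside the board a position is constrained only by `free⇒<`, which makes every free cell a
  -- legal move.
  record Represents (σ : Position) (D S : VSet (P 2 □ P n)) : Set where
    field
      D⇒dom  : ∀ {v} → D v → σ at cell v ≡ dom
      dom⇒D  : ∀ {v} → σ at cell v ≡ dom → D v
      S⇒stal : ∀ {v} → S v → σ at cell v ≡ stal
      stal⇒S : ∀ {v} → σ at cell v ≡ stal → S v
      free⇒< : ∀ {u} → σ at u ≡ free → col u < n

    unclaimed⇒free : ∀ {v} → Unclaimed D S v → σ at cell v ≡ free
    unclaimed⇒free {v} (¬D , ¬S) with σ at cell v in eq
    ... | free = refl
    ... | dom  = contradiction (dom⇒D eq) ¬D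
    ... | stal = contradiction (stal⇒S eq) ¬S

    free⇒unclaimed : ∀ {v} → σ at cell v ≡ free → Unclaimed D S v
    free⇒unclaimed v-free =
      (λ d → free⇒undom v-free (D⇒dom d)) , (λ s → stal⇒unfree (S⇒stal s) v-free)

  open Represents

  staller-claims : ∀ {σ D S v} → Represents σ D S → σ at cell v ≡ free →
                   Represents (σ [ cell v ≔ staller ]) D (_⊕_ {P 2 □ P n} S v)
  staller-claims {σ} {D} {S} {v} R v-free = record
    { D⇒dom  = keep-claim v-free ∘ D⇒dom R
    ; dom⇒D  = back-dom
    ; S⇒stal = λ { (inj₁ s) → keep-claim v-free (S⇒stal R s) ; (inj₂ refl) → placed }
    ; stal⇒S = back-stal
    ; free⇒< = free⇒< R ∘ proj₂ ∘ unplace-free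
    }
    where
    back-dom : ∀ {u} → (σ [ cell v ≔ staller ]) at cell u ≡ dom → D u
    back-dom eq with unplace eq
    ... | inj₂ (_ , u-dom) = dom⇒D R u-dom
    back-stal : ∀ {u} → (σ [ cell v ≔ staller ]) at cell u ≡ stal → S u ⊎ u ≡ v
    back-stal eq with unplace eq
    ... | inj₁ (e , _)      = inj₂ (cell-injective e)
    ... | inj₂ (_ , u-stal) = inj₁ (stal⇒S R u-stal)

  dominator-claims : ∀ {σ D S v} → Represents σ D S → σ at cell v ≡ free →
                     Represents (σ [ cell v ≔ dominator ]) (_⊕_ {P 2 □ P n} D v) S
  dominator-claims {σ} {D} {S} {v} R v-free = record
    { D⇒dom  = λ { (inj₁ d) → keep-claim v-free (D⇒dom R d) ; (inj₂ refl) → placed }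
    ; dom⇒D  = back-dom
    ; S⇒stal = keep-claim v-free ∘ S⇒stal R
    ; stal⇒S = back-stal
    ; free⇒< = free⇒< R ∘ proj₂ ∘ unplace-free
    }
    where
    back-dom : ∀ {u} → (σ [ cell v ≔ dominator ]) at cell u ≡ dom → D u ⊎ u ≡ v
    back-dom eq with unplace eq
    ... | inj₁ (e , _)     = inj₂ (cell-injective e)
    ... | inj₂ (_ , u-dom) = inj₁ (dom⇒D R u-dom)
    back-stal : ∀ {u} → (σ [ cell v ≔ dominator ]) at cell u ≡ stal → S u
    back-stal eq with unplace eq
    ... | inj₂ (_ , u-stal) = stal⇒S R u-stal

  -- As `k < m` is strict, `m` is a lower bound on the moves Dominator still needs, and `Stalls 0`
  -- is vacuous.
  Stalls Stallsᴰ : ℕ → Position → Set₁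
  Stalls  m σ = ∀ {k D S} → k < m → Represents σ D S → ¬ WinS k D S
  Stallsᴰ m σ = ∀ {k D S} → k < m → Represents σ D S → ¬ WinD k D S

  Undominated : Position → Cell → Set
  Undominated σ t = col t < n × (∀ {u} → u ∈N[ t ] → σ at u ≢ dom)

  preimage : ∀ t → col t < n → ∃[ v ] cell v ≡ t
  preimage (r , c) c<n = (r , fromℕ< c<n) , cong (r ,_) (toℕ-fromℕ< c<n)

  ¬dominating : ∀ {σ D S t} → Undominated σ t → Represents σ D S → ¬ Dominating D
  ¬dominating {t = t} (t<n , undom) R D-dom with preimage t t<n
  ... | v , refl with D-dom v
  ...   | inj₁ v∈D             = undom self (D⇒dom R v∈D)
  ...   | inj₂ (u , v∼u , u∈D) = undom (∼⇒∈N v∼u) (D⇒dom R u∈D)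

  -- The undominated `t` excludes that Dominator has already won, so his plan must contain an answer
  -- to `v`.
  staller-move : ∀ {m σ t v} → Undominated σ t → σ at v ≡ free →
                 Stallsᴰ m (σ [ v ≔ staller ]) → Stalls m σ
  staller-move U v-free next k<m R (inj₁ D-dom) = ¬dominating U R D-dom
  staller-move {v = v} U v-free next k<m R (inj₂ win) with preimage v (free⇒< R v-free)
  ... | w , refl =
    next k<m (staller-claims R v-free) (proj₂ (win w (free⇒unclaimed R v-free)))

  -- The undominated `t` excludes stopping here, so Dominator has to spend one unit of his budget on
  -- a move.
  dominator-move : ∀ {m σ t} → Undominated σ t →
                   (∀ {u} → σ at u ≡ free → Stalls m (σ [ u ≔ dominator ])) →
                   Stallsᴰ (suc m) σ
  dominator-move U next {zero}  _   R D-dom        = ¬dominating U R D-dom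
  dominator-move U next {suc k} _   R (inj₁ D-dom) = ¬dominating U R D-dom
  dominator-move U next {suc k} k<m R (inj₂ (u , u-unclaimed , win)) =
    next u-free (s≤s⁻¹ k<m) (dominator-claims R u-free) win
    where u-free = unclaimed⇒free R u-unclaimed

  -- Claiming `v` completes the closed neighbourhood of `t`, which `WinS` forbids; hence no budget
  -- helps Dominator and `m` is arbitrary.
  staller-wins : ∀ {m σ t v} → col t < n → σ at v ≡ free →
                 (∀ {u} → u ∈N[ t ] → u ≢ v → σ at u ≡ stal) → Stalls m σ
  staller-wins {σ = σ} {t} {v} t<n v-free closed k<m R win with preimage v (free⇒< R v-free)
  ... | w , refl with preimage t t<n
  ...   | x , refl = go win
    where
    undom : ∀ {u} → u ∈N[ t ] → σ at u ≢ dom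
    undom {u} u∈N with u ≟ cell w
    ... | yes refl = free⇒undom v-free
    ... | no  u≢v  = stal⇒undom (closed u∈N u≢v)
    claimed : ∀ {u} → cell u ∈N[ t ] → _ ⊎ u ≡ w
    claimed {u} u∈N with cell u ≟ cell w
    ... | yes e = inj₂ (cell-injective e)
    ... | no  u≢v = inj₁ (stal⇒S R (closed u∈N u≢v))
    go : _ → _
    go (inj₁ D-dom) = ¬dominating (t<n , undom) R D-dom
    go (inj₂ win)   = proj₁ (win w (free⇒unclaimed R v-free))
                            (x , claimed self , λ u x∼u → claimed (∼⇒∈N x∼u))

  -- Once Staller holds `v`, no cell around `t` except `x` can be free. Any reply other than `x`
  -- lets her take `x` and win at `t`.
  forced : ∀ {m σ t v x} → Undominated σ t →
           (∀ {u} → u ∈N[ t ] → σ at u ≡ free → u ≡ v ⊎ u ≡ x) →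
           σ at v ≡ free → σ at x ≡ free → v ≢ x →
           Stalls m ((σ [ v ≔ staller ]) [ x ≔ dominator ]) → Stalls (suc m) σ
  forced {m} {σ} {t} {v} {x} (t<n , undom) only v-free x-free v≢x next =
    staller-move (t<n , undom) v-free
      (dominator-move (t<n , keep-undomˢ ∘ undom) reply)
    where
    reply : ∀ {u} → (σ [ v ≔ staller ]) at u ≡ free → Stalls m ((σ [ v ≔ staller ]) [ u ≔ dominator ])
    reply {u} u-free' with u ≟ x | unplace-free u-free'
    ... | yes refl | _ = next
    ... | no u≢x   | u≢v , u-free =
      staller-wins t<n (keep (≢-sym u≢x) (keep (≢-sym v≢x) x-free)) closed
      where
      closed : ∀ {w} → w ∈N[ t ] → w ≢ x → ((σ [ v ≔ staller ]) [ u ≔ dominator ]) at w ≡ stal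
      closed {w} w∈N w≢x with w ≟ v
      ... | yes refl = keep (≢-sym u≢v) (placed)
      ... | no  w≢v  = keep-claim (keep u≢v u-free)
                         (keep w≢v (settle (undom w∈N) ([ w≢v , w≢x ]′ ∘ only w∈N)))

-- Lines of forced replies

-- In column c Staller's next threat is to the cell (τ , c) and Dominator's forced reply is (ρ , c);
-- τ' and ρ' are the opposite rows.  One step later the rows are ρ' and τ', so the replies stay in
-- one row when τ ≢ ρ and alternate between the rows when τ ≡ ρ.  Hits says that y is one of them.
data Hits (y : Cell) : (τ τ' ρ ρ' : Row) → ℕ → Set where
  here  : ∀ {τ τ' ρ ρ' c} → y ≡ (ρ , c) → Hits y τ τ' ρ ρ' c
  there : ∀ {τ τ' ρ ρ' c} → Hits y ρ' ρ τ' τ c → Hits y τ τ' ρ ρ' (suc c)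

hits-col : ∀ {y τ τ' ρ ρ' c} → Hits y τ τ' ρ ρ' c → col y ≤ c
hits-col (here refl) = ≤-refl
hits-col (there h)   = m≤n⇒m≤1+n (hits-col h)

-- Keeps Staller's own next cell distinct from Dominator's `y`, so that she can claim it.
hits-misses : ∀ {y τ τ' ρ ρ' c} → ρ ≢ ρ' → Hits y τ τ' ρ ρ' c → y ≢ (ρ' , c)
hits-misses ρ≢ρ' (here refl) refl = ρ≢ρ' refl
hits-misses _    (there h)   refl = <-irrefl refl (hits-col h)

-- The rows `ρ' ρ ρ ρ'` are a fixed point of the exchange made by `there`.
hits-straight : ∀ {ρ ρ' i} c → i ≤ c → Hits (ρ , i) ρ' ρ ρ ρ' c
hits-straight c i≤c with m≤n⇒m<n∨m≡n i≤c
hits-straight c       _ | inj₂ refl    = here refl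
hits-straight (suc c) _ | inj₁ (s≤s i≤c) = there (hits-straight c i≤c)

-- The exchange made by `there` swaps the two alternating lines. In every column they occupy
-- different rows, so one of them contains the given cell.
hits-alternating : ∀ {a b r i} → a ≢ b → ∀ c → i ≤ c →
                   Hits (r , i) a b a b c ⊎ Hits (r , i) b a b a c
hits-alternating {r = r} a≢b c i≤c with m≤n⇒m<n∨m≡n i≤c
hits-alternating {r = r} a≢b c _ | inj₂ refl with row-dichotomy a≢b r
... | inj₁ refl = inj₁ (here refl)
... | inj₂ refl = inj₂ (here refl)
hits-alternating a≢b (suc c) _ | inj₁ (s≤s i≤c) with hits-alternating a≢b c i≤c
... | inj₁ h = inj₂ (there h)
... | inj₂ h = inj₁ (there h)

-- Invariants of the sweep

module Strategy (n : ℕ) where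

  open Staller n

  -- s can be adjacent to (a , c - 1) but not to (b , c - 1), and p the other way round: this is
  -- what a≢p and b≢s say, since (a , c) and (b , c) are the only neighbours above them.
  record Front (σ : Position) (c : ℕ) (a b : Row) (s p : Cell) : Set where
    field
      inside     : c < n
      a≢b        : a ≢ b
      below-free : ∀ {u} → col u < c → σ at u ≡ free
      s-free     : σ at s ≡ free
      p-free     : σ at p ≡ free
      s≢p        : s ≢ p
      s-col      : c ≤ col s
      p-col      : c ≤ col p
      where-free : ∀ {u} → σ at u ≡ free → col u < c ⊎ u ≡ s ⊎ u ≡ p
      a-undom    : σ at (a , c) ≢ dom
      b-undom    : σ at (b , c) ≢ dom
      up-undom   : σ at (a , suc c) ≢ dom
      a≢p        : (a , c) ≢ p
      b≢s        : (b , c) ≢ s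

    front-undominated : Undominated σ (a , c)
    front-undominated = inside , undom
      where
      undom : ∀ {u} → u ∈N[ a , c ] → σ at u ≢ dom
      undom self = a-undom
      undom (flip {r' = r'} a≢r') with row-dichotomy a≢b r'
      ... | inj₁ refl = contradiction refl a≢r'
      ... | inj₂ refl = b-undom
      undom up   = up-undom
      undom down = free⇒undom (below-free (n<1+n _))

  -- The sweep towards a cell y that Dominator already owns; x-free concerns the next forced reply.
  record Line (σ : Position) (c : ℕ) (τ τ' ρ ρ' : Row) (y : Cell) : Set where
    field
      inside     : c < n
      τ≢τ'       : τ ≢ τ'
      ρ≢ρ'       : ρ ≢ ρ'
      y-dom      : σ at y ≡ dom
      other-stal : σ at (ρ' , c) ≡ stal
      up-stal    : σ at (τ , suc c) ≡ stal
      below-free : ∀ {u} → u ≢ y → col u < c → σ at u ≡ free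
      x-free     : y ≢ (ρ , c) → σ at (ρ , c) ≡ free
      where-free : ∀ {u} → σ at u ≡ free → col u < c ⊎ u ≡ (ρ , c)

  -- The position after Staller's move (a , c) against a front at column c + 1 and a reply y
  -- other than s and p.
  record Loose (σ : Position) (c : ℕ) (a b : Row) (s p y : Cell) : Set where
    field
      inside     : suc c < n
      a≢b        : a ≢ b
      z-stal     : σ at (a , c) ≡ stal
      y-dom      : σ at y ≡ dom
      y-col      : col y ≤ c
      below-free : ∀ {u} → u ≢ (a , c) → u ≢ y → col u ≤ c → σ at u ≡ free
      s-free     : σ at s ≡ free
      p-free     : σ at p ≡ free
      s≢p        : s ≢ p
      s-col      : c < col s
      p-col      : c < col p
      where-free : ∀ {u} → σ at u ≡ free → col u ≤ c ⊎ u ≡ s ⊎ u ≡ p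
      a-undom    : σ at (a , suc c) ≢ dom
      b-undom    : σ at (b , suc c) ≢ dom
      up-undom   : σ at (a , suc (suc c)) ≢ dom
      a≢p        : (a , suc c) ≢ p
      b≢s        : (b , suc c) ≢ s

    y≢z : y ≢ (a , c)
    y≢z refl with trans (sym z-stal) y-dom
    ... | ()

    inside′ : c < n
    inside′ = ≤-trans (n≤1+n _) inside

    loose-undominated : Undominated σ (a , suc c)
    loose-undominated = inside , undom
      where
      undom : ∀ {u} → u ∈N[ a , suc c ] → σ at u ≢ dom
      undom self = a-undom
      undom (flip {r' = r'} a≢r') with row-dichotomy a≢b r'
      ... | inj₁ refl = contradiction refl a≢r'
      ... | inj₂ refl = b-undom
      undom up   = up-undom
      undom down = stal⇒undom z-stal

    -- The neighbour below is Staller's `(a , c)`, and all others lie in columns above `c`, where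
    -- only `s` and `p` are free. This makes `s` and `p` a forcing pair.
    only-s-p : ∀ {u} → u ∈N[ a , suc c ] → σ at u ≡ free → u ≡ s ⊎ u ≡ p
    only-s-p u∈N u-free with where-free u-free
    only-s-p self     _      | inj₁ lt = contradiction lt (<⇒≱ (n<1+n _))
    only-s-p (flip _) _      | inj₁ lt = contradiction lt (<⇒≱ (n<1+n _))
    only-s-p up       _      | inj₁ lt = contradiction lt (<⇒≱ (s≤s (n≤1+n _)))
    only-s-p down     u-free | inj₁ _  = contradiction u-free (stal⇒unfree z-stal)
    only-s-p _        _      | inj₂ e  = e

  open Front
  open Line
  open Loose

  -- Mutual induction on the column

  mutual

    -- Staller takes the cell below the undominated one. Every reply costs Dominator one unit: `s`
    -- or `p` recreates a front one column lower, and any other free cell lies below the front and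
    -- gives a `Loose` position.
    front : ∀ {σ a b s p} c → Front σ c a b s p → Stalls (suc c) σ
    front {a = a} zero F =
      staller-move (front-undominated F) (s-free F)
        -- One reply is enough here: after it only the vacuous `Stalls 0` remains.
        (dominator-move {t = a , zero} (inside F , keep-undomˢ ∘ proj₂ (front-undominated F)) (λ _ ()))
    front {σ} {a} {b} {s} {p} (suc c) F =
      staller-move (front-undominated F) z-free
        (dominator-move {t = a , suc c} (inside F , keep-undomˢ ∘ proj₂ (front-undominated F)) reply)
      where
      z : Cell
      z = a , c

      σ₁ : Position
      σ₁ = σ [ z ≔ staller ]

      z-free : σ at z ≡ free
      z-free = below-free F (n<1+n c)

      above≢ : ∀ {u v} → suc c ≤ col u → col v ≤ c → v ≢ u
      above≢ {u} hi lo = col<⇒≢ (≤-trans (s≤s lo) hi)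

      s≢z : s ≢ z
      s≢z = ≢-sym (above≢ (s-col F) ≤-refl)

      p≢z : p ≢ z
      p≢z = ≢-sym (above≢ (p-col F) ≤-refl)

      -- By `a≢p` the reply leaves `(a , c)` undominated, so the target row stays `a` and `(b , c)`
      -- replaces `p`.
      after-p : Front (σ₁ [ p ≔ dominator ]) c a b s (b , c)
      after-p = record
        { inside     = ≤-trans (n≤1+n _) (inside F)
        ; a≢b        = a≢b F
        ; below-free = λ lt → keep (above≢ (p-col F) (≤-trans (n≤1+n _) lt))
                                (keep (col<⇒≢ lt) (below-free F (m≤n⇒m≤1+n lt)))
        ; s-free     = keep (s≢p F) (keep s≢z (s-free F))
        ; p-free     = b-free
        ; s≢p        = ≢-sym (above≢ (s-col F) ≤-refl)
        ; s-col      = ≤-trans (n≤1+n _) (s-col F)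
        ; p-col      = ≤-refl
        ; where-free = locate
        ; a-undom    = keep-undom (above≢ (p-col F) ≤-refl) (stal⇒undom (placed {σ}))
        ; b-undom    = free⇒undom b-free
        ; up-undom   = keep-undom (a≢p F) (keep-undomˢ (a-undom F))
        ; a≢p        = row≢⇒≢ (a≢b F)
        ; b≢s        = above≢ (s-col F) ≤-refl
        }
        where
        b-free : (σ₁ [ p ≔ dominator ]) at (b , c) ≡ free
        b-free = keep (above≢ (p-col F) ≤-refl)
                   (keep (row≢⇒≢ (≢-sym (a≢b F))) (below-free F (n<1+n c)))
        locate : ∀ {u} → (σ₁ [ p ≔ dominator ]) at u ≡ free → col u < c ⊎ u ≡ s ⊎ u ≡ (b , c)
        locate u-free₂ with unplace-free u-free₂
        ... | u≢p , u-free₁ with unplace-free u-free₁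
        ...   | u≢z , u-free with where-free F u-free
        ...     | inj₂ (inj₁ u≡s) = inj₂ (inj₁ u≡s)
        ...     | inj₂ (inj₂ u≡p) = contradiction u≡p u≢p
        ...     | inj₁ (s≤s lt) with m≤n⇒m<n∨m≡n lt
        ...       | inj₁ lt' = inj₁ lt'
        locate {r , _} _ | _ | u≢z , _ | inj₁ _ | inj₂ refl with row-dichotomy (a≢b F) r
        ... | inj₁ refl = contradiction refl u≢z
        ... | inj₂ refl = inj₂ (inj₂ refl)

      -- By `b≢s` the reply leaves `(b , c)` undominated, so the rows change roles and `(b , c)`
      -- replaces `s`.
      after-s : Front (σ₁ [ s ≔ dominator ]) c b a (b , c) p
      after-s = record
        { inside     = ≤-trans (n≤1+n _) (inside F)
        ; a≢b        = ≢-sym (a≢b F)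
        ; below-free = λ lt → keep (above≢ (s-col F) (≤-trans (n≤1+n _) lt))
                                (keep (col<⇒≢ lt) (below-free F (m≤n⇒m≤1+n lt)))
        ; s-free     = b-free
        ; p-free     = keep (≢-sym (s≢p F)) (keep p≢z (p-free F))
        ; s≢p        = above≢ (p-col F) ≤-refl
        ; s-col      = ≤-refl
        ; p-col      = ≤-trans (n≤1+n _) (p-col F)
        ; where-free = locate
        ; a-undom    = free⇒undom b-free
        ; b-undom    = keep-undom (above≢ (s-col F) ≤-refl) (stal⇒undom (placed {σ}))
        ; up-undom   = keep-undom (b≢s F) (keep-undomˢ (b-undom F))
        ; a≢p        = above≢ (p-col F) ≤-refl
        ; b≢s        = row≢⇒≢ (a≢b F)
        }
        where
        b-free : (σ₁ [ s ≔ dominator ]) at (b , c) ≡ free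
        b-free = keep (above≢ (s-col F) ≤-refl)
                   (keep (row≢⇒≢ (≢-sym (a≢b F))) (below-free F (n<1+n c)))
        locate : ∀ {u} → (σ₁ [ s ≔ dominator ]) at u ≡ free → col u < c ⊎ u ≡ (b , c) ⊎ u ≡ p
        locate u-free₂ with unplace-free u-free₂
        ... | u≢s , u-free₁ with unplace-free u-free₁
        ...   | u≢z , u-free with where-free F u-free
        ...     | inj₂ (inj₁ u≡s) = contradiction u≡s u≢s
        ...     | inj₂ (inj₂ u≡p) = inj₂ (inj₂ u≡p)
        ...     | inj₁ (s≤s lt) with m≤n⇒m<n∨m≡n lt
        ...       | inj₁ lt' = inj₁ lt'
        locate {r , _} _ | _ | u≢z , _ | inj₁ _ | inj₂ refl with row-dichotomy (a≢b F) r
        ... | inj₁ refl = contradiction refl u≢z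
        ... | inj₂ refl = inj₂ (inj₁ refl)

      after-y : ∀ {y} → col y ≤ c → σ₁ at y ≡ free → Loose (σ₁ [ y ≔ dominator ]) c a b s p y
      after-y {y} y-low y-free₁ = record
        { inside     = inside F
        ; a≢b        = a≢b F
        ; z-stal     = keep (≢-sym (proj₁ (unplace-free y-free₁))) (placed {σ})
        ; y-dom      = placed
        ; y-col      = y-low
        ; below-free = λ u≢z u≢y lt → keep u≢y (keep u≢z (below-free F (s≤s lt)))
        ; s-free     = keep (≢-sym (above≢ (s-col F) y-low)) (keep s≢z (s-free F))
        ; p-free     = keep (≢-sym (above≢ (p-col F) y-low)) (keep p≢z (p-free F))
        ; s≢p        = s≢p F
        ; s-col      = s-col F
        ; p-col      = p-col F
        ; where-free = locate
        ; a-undom    = keep-undom (≢-sym (col<⇒≢ (s≤s y-low))) (keep-undomˢ (a-undom F))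
        ; b-undom    = keep-undom (≢-sym (col<⇒≢ (s≤s y-low))) (keep-undomˢ (b-undom F))
        ; up-undom   = keep-undom (≢-sym (col<⇒≢ (s≤s (m≤n⇒m≤1+n y-low)))) (keep-undomˢ (up-undom F))
        ; a≢p        = a≢p F
        ; b≢s        = b≢s F
        }
        where
        locate : ∀ {u} → (σ₁ [ y ≔ dominator ]) at u ≡ free → col u ≤ c ⊎ u ≡ s ⊎ u ≡ p
        locate u-free₂ with where-free F (proj₂ (unplace-free (proj₂ (unplace-free u-free₂))))
        ... | inj₁ (s≤s lt) = inj₁ lt
        ... | inj₂ e        = inj₂ e

      reply : ∀ {u} → σ₁ at u ≡ free → Stalls (suc c) (σ₁ [ u ≔ dominator ])
      reply u-free₁ with where-free F (proj₂ (unplace-free u-free₁))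
      ... | inj₁ (s≤s lt)    = loose c (after-y lt u-free₁)
      ... | inj₂ (inj₁ refl) = front c after-s
      ... | inj₂ (inj₂ refl) = front c after-p

    -- The columns from `c` down to 0 account for `c + 1` replies, of which `y` is already made;
    -- this leaves the bound `c`.
    line : ∀ {σ τ τ' ρ ρ' y} c → Line σ c τ τ' ρ ρ' y → Hits y τ τ' ρ ρ' c → Stalls c σ
    line zero L _ ()
    -- Now `y` stands where the forced reply would go. All lower columns are untouched, so a new
    -- front starts just below, with target row `ρ'` because `(ρ' , suc c)` is Staller's.
    line {σ} {ρ = ρ} {ρ'} (suc c) L (here refl) = front c record
      { inside     = ≤-trans (n≤1+n _) (inside L)
      ; a≢b        = ≢-sym (ρ≢ρ' L)
      ; below-free = λ lt → low-free (≤-trans (n≤1+n _) lt)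
      ; s-free     = low-free ≤-refl
      ; p-free     = low-free ≤-refl
      ; s≢p        = row≢⇒≢ (≢-sym (ρ≢ρ' L))
      ; s-col      = ≤-refl
      ; p-col      = ≤-refl
      ; where-free = locate
      ; a-undom    = free⇒undom (low-free ≤-refl)
      ; b-undom    = free⇒undom (low-free ≤-refl)
      ; up-undom   = stal⇒undom (other-stal L)
      ; a≢p        = row≢⇒≢ (≢-sym (ρ≢ρ' L))
      ; b≢s        = row≢⇒≢ (ρ≢ρ' L)
      }
      where
      low-free : ∀ {u} → col u ≤ c → σ at u ≡ free
      low-free lt = below-free L (col<⇒≢ (s≤s lt)) (s≤s lt)
      locate : ∀ {u} → σ at u ≡ free → col u < c ⊎ u ≡ (ρ' , c) ⊎ u ≡ (ρ , c)
      locate u-free with where-free L u-free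
      ... | inj₂ refl = contradiction u-free (dom⇒unfree (y-dom L))
      ... | inj₁ (s≤s lt) with m≤n⇒m<n∨m≡n lt
      ...   | inj₁ lt' = inj₁ lt'
      locate {r , _} _ | _ | inj₂ refl with row-dichotomy (ρ≢ρ' L) r
      ... | inj₁ refl = inj₂ (inj₂ refl)
      ... | inj₂ refl = inj₂ (inj₁ refl)
    line {σ} {τ} {τ'} {ρ} {ρ'} {y} (suc c) L (there h) =
      -- Around `(τ , suc c)` only `v` below it and the one free cell `x` of its column are left.
      forced {t = τ , suc c} (inside L , undom) only v-free x-free₀ (col<⇒≢ ≤-refl) (line c next h)
      where
      v x : Cell
      v = τ , c
      x = ρ , suc c

      y<x : col y < suc c
      y<x = s≤s (hits-col h)

      x-free₀ : σ at x ≡ free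
      x-free₀ = x-free L (col<⇒≢ y<x)

      v≢y : v ≢ y
      v≢y = ≢-sym (hits-misses (≢-sym (τ≢τ' L)) h)

      v-free : σ at v ≡ free
      v-free = below-free L v≢y ≤-refl

      column : ∀ r → (r , suc c) ≡ x ⊎ σ at (r , suc c) ≡ stal
      column r with row-dichotomy (ρ≢ρ' L) r
      ... | inj₁ refl = inj₁ refl
      ... | inj₂ refl = inj₂ (other-stal L)

      column-undom : ∀ r → σ at (r , suc c) ≢ dom
      column-undom r with column r
      ... | inj₁ refl = free⇒undom x-free₀
      ... | inj₂ st   = stal⇒undom st

      undom : ∀ {u} → u ∈N[ τ , suc c ] → σ at u ≢ dom
      undom self     = column-undom _
      undom (flip _) = column-undom _
      undom up       = stal⇒undom (up-stal L)
      undom down     = free⇒undom v-free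

      column-only : ∀ r → σ at (r , suc c) ≡ free → (r , suc c) ≡ v ⊎ (r , suc c) ≡ x
      column-only r r-free with column r
      ... | inj₁ e  = inj₂ e
      ... | inj₂ st = contradiction r-free (stal⇒unfree st)

      only : ∀ {u} → u ∈N[ τ , suc c ] → σ at u ≡ free → u ≡ v ⊎ u ≡ x
      only self     u-free = column-only _ u-free
      only (flip _) u-free = column-only _ u-free
      only up       u-free = contradiction u-free (stal⇒unfree (up-stal L))
      only down     _      = inj₁ refl

      x-free₁ : (σ [ v ≔ staller ]) at x ≡ free
      x-free₁ = keep (≢-sym (col<⇒≢ ≤-refl)) x-free₀

      -- Staller's new cell `v` becomes `other-stal`, and the old `other-stal` becomes `up-stal`;
      -- this is the exchange of rows in `there`.
      next : Line ((σ [ v ≔ staller ]) [ x ≔ dominator ]) c ρ' ρ τ' τ y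
      next = record
        { inside     = ≤-trans (n≤1+n _) (inside L)
        ; τ≢τ'       = ≢-sym (ρ≢ρ' L)
        ; ρ≢ρ'       = ≢-sym (τ≢τ' L)
        ; y-dom      = keep-claim x-free₁ (keep-claim v-free (y-dom L))
        ; other-stal = keep-claim x-free₁ (placed {σ})
        ; up-stal    = keep-claim x-free₁ (keep-claim v-free (other-stal L))
        ; below-free = λ u≢y lt → keep (col<⇒≢ (m≤n⇒m≤1+n lt))
                                    (keep (col<⇒≢ lt) (below-free L u≢y (m≤n⇒m≤1+n lt)))
        ; x-free     = λ y≢x' → keep (col<⇒≢ ≤-refl) (keep (row≢⇒≢ (≢-sym (τ≢τ' L)))
                                    (below-free L (≢-sym y≢x') ≤-refl))
        ; where-free = locate
        }
        where
        locate : ∀ {u} → ((σ [ v ≔ staller ]) [ x ≔ dominator ]) at u ≡ free → col u < c ⊎ u ≡ (τ' , c)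
        locate u-free₂ with unplace-free u-free₂
        ... | u≢x , u-free₁ with unplace-free u-free₁
        ...   | u≢v , u-free with where-free L u-free
        ...     | inj₂ u≡x = contradiction u≡x u≢x
        ...     | inj₁ (s≤s lt) with m≤n⇒m<n∨m≡n lt
        ...       | inj₁ lt' = inj₁ lt'
        locate {r , _} _ | _ | u≢v , _ | inj₁ _ | inj₂ refl with row-dichotomy (τ≢τ' L) r
        ... | inj₁ refl = contradiction refl u≢v
        ... | inj₂ refl = inj₂ refl

    -- The replies to come start at `(b , c)`. A straight line reaches every `y` in row `b`; for row
    -- `a` an alternating line is needed, and its parity may fail.
    loose : ∀ {σ a b s p y} c → Loose σ c a b s p y → Stalls (suc c) σ
    loose {y = y} c W with row-dichotomy (a≢b W) (proj₁ y)
    loose c W | inj₂ refl = straight c W (hits-straight c (y-col W))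
    loose c W | inj₁ refl with hits-alternating (a≢b W) c (y-col W)
    ... | inj₂ h         = zigzag c W h
    -- The other alternating line starts at `(a , c)`, which Staller owns.
    ... | inj₁ (here e)  = contradiction e (y≢z W)
    ... | inj₁ (there h) = shifted _ W h

    -- Taking `s` forces `p`. Since `(a , suc c)` is not `p`, it ends up Staller's, and the next
    -- threat is to `(a , c)`.
    straight : ∀ {σ a b s p y} c → Loose σ c a b s p y → Hits y a b b a c → Stalls (suc c) σ
    straight {a = a} c W h =
      forced {t = a , suc c} (loose-undominated W) (only-s-p W) (s-free W) (p-free W) (s≢p W)
        (line c (to-line W (a≢b W) (s-free W) (p-free W) (s-col W) (p-col W) (s≢p W)
                   (where-free W) (a-undom W) (a≢p W)) h)

    -- Taking `p` instead forces `s`, which is not `(b , suc c)`. The next threat is then to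
    -- `(b , c)`, and the replies alternate.
    zigzag : ∀ {σ a b s p y} c → Loose σ c a b s p y → Hits y b a b a c → Stalls (suc c) σ
    zigzag {a = a} c W h =
      forced {t = a , suc c} (loose-undominated W) (λ u∈N → swap ∘ only-s-p W u∈N)
        (p-free W) (s-free W) (≢-sym (s≢p W))
        (line c (to-line W (≢-sym (a≢b W)) (p-free W) (s-free W) (p-col W) (s-col W) (≢-sym (s≢p W))
                   (map₂ swap ∘ where-free W) (b-undom W) (b≢s W)) h)

    -- After `v` and `x` nothing above column `c` is free, so `(τ , suc c)`, not being Dominator's,
    -- belongs to Staller.
    to-line : ∀ {σ c a b s p y τ τ' v x} → Loose σ c a b s p y → τ ≢ τ' →
              σ at v ≡ free → σ at x ≡ free → c < col v → c < col x → v ≢ x →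
              (∀ {u} → σ at u ≡ free → col u ≤ c ⊎ u ≡ v ⊎ u ≡ x) →
              σ at (τ , suc c) ≢ dom → (τ , suc c) ≢ x →
              Line ((σ [ v ≔ staller ]) [ x ≔ dominator ]) c τ τ' b a y
    to-line {σ} {c} {a} {b} {τ = τ} {v = v} {x}
            W τ≢τ' v-free x-free c<v c<x v≢x where-f τ-undom τ≢x = record
      { inside     = inside′ W
      ; τ≢τ'       = τ≢τ'
      ; ρ≢ρ'       = ≢-sym (a≢b W)
      ; y-dom      = keep-claim x-free₁ (keep-claim v-free (y-dom W))
      ; other-stal = keep-claim x-free₁ (keep-claim v-free (z-stal W))
      ; up-stal    = settle (keep-undom τ≢x (keep-undomˢ τ-undom)) up-claimed
      ; below-free = λ u≢y lt → low (<⇒≤ lt) (below-free W (col<⇒≢ lt) u≢y (<⇒≤ lt))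
      ; x-free     = λ y≢x → low ≤-refl (below-free W (row≢⇒≢ (≢-sym (a≢b W))) (≢-sym y≢x) ≤-refl)
      ; where-free = locate
      }
      where
      x-free₁ : (σ [ v ≔ staller ]) at x ≡ free
      x-free₁ = keep (≢-sym v≢x) x-free
      low : ∀ {u} → col u ≤ c → σ at u ≡ free → ((σ [ v ≔ staller ]) [ x ≔ dominator ]) at u ≡ free
      low lt = keep (col<⇒≢ (≤-trans (s≤s lt) c<x)) ∘ keep (col<⇒≢ (≤-trans (s≤s lt) c<v))
      still-free : ∀ {u} → ((σ [ v ≔ staller ]) [ x ≔ dominator ]) at u ≡ free →
                   σ at u ≡ free × col u ≤ c
      still-free u-free₂ with unplace-free u-free₂
      ... | u≢x , u-free₁ with unplace-free u-free₁
      ...   | u≢v , u-free with where-f u-free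
      ...     | inj₁ lt         = u-free , lt
      ...     | inj₂ (inj₁ u≡v) = contradiction u≡v u≢v
      ...     | inj₂ (inj₂ u≡x) = contradiction u≡x u≢x
      up-claimed : ((σ [ v ≔ staller ]) [ x ≔ dominator ]) at (τ , suc c) ≢ free
      up-claimed f = <-irrefl refl (proj₂ (still-free f))
      locate : ∀ {u} → ((σ [ v ≔ staller ]) [ x ≔ dominator ]) at u ≡ free → col u < c ⊎ u ≡ (b , c)
      locate {r , _} u-free₂ with still-free u-free₂
      ... | u-free , lt with m≤n⇒m<n∨m≡n lt
      ...   | inj₁ lt' = inj₁ lt'
      ...   | inj₂ refl with row-dichotomy (a≢b W) r
      ...     | inj₁ refl = contradiction u-free (stal⇒unfree (z-stal W))
      ...     | inj₂ refl = inj₂ refl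

    -- Here y is in row a and the alternating line has the wrong parity.  Staller's extra move w
    -- leaves Dominator only s and p as replies, and puts the line in step with y.
    shifted : ∀ {σ a b s p i} c → Loose σ (suc c) a b s p (a , i) →
              Hits (a , i) b a b a c → Stalls (suc (suc c)) σ
    shifted {σ} {a} {b} {s} {p} {i} c W h =
      staller-move {t = a , 2+ c} (loose-undominated W) w-free
        (dominator-move {t = a , 2+ c} undom₁ reply)
      where
      y w az bz : Cell
      y = a , i
      w = b , suc c
      az = a , c
      bz = b , c

      i≤c : i ≤ c
      i≤c = hits-col h

      σ₁ : Position
      σ₁ = σ [ w ≔ staller ]

      b≢a : b ≢ a
      b≢a = ≢-sym (a≢b W)

      w-free : σ at w ≡ free
      w-free = below-free W (row≢⇒≢ b≢a) (row≢⇒≢ b≢a) ≤-refl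

      undom₁ : Undominated σ₁ (a , 2+ c)
      undom₁ = inside W , keep-undomˢ ∘ proj₂ (loose-undominated W)

      az≢y : az ≢ y
      az≢y = ≢-sym (hits-misses b≢a h)

      low-free : ∀ {u} → u ≢ y → col u ≤ c → σ₁ at u ≡ free
      low-free u≢y lt = keep (col<⇒≢ (s≤s lt))
        (below-free W (col<⇒≢ (s≤s lt)) u≢y (m≤n⇒m≤1+n lt))

      az-free : σ₁ at az ≡ free
      az-free = low-free az≢y ≤-refl

      bz-free : σ₁ at bz ≡ free
      bz-free = low-free (row≢⇒≢ b≢a) ≤-refl

      s>c : c < col s
      s>c = ≤-trans (n≤1+n _) (s-col W)

      p>c : c < col p
      p>c = ≤-trans (n≤1+n _) (p-col W)

      s-free₁ : σ₁ at s ≡ free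
      s-free₁ = keep (≢-sym (col<⇒≢ (s-col W))) (s-free W)

      p-free₁ : σ₁ at p ≡ free
      p-free₁ = keep (≢-sym (col<⇒≢ (p-col W))) (p-free W)

      z-stal₁ : σ₁ at (a , suc c) ≡ stal
      z-stal₁ = keep-claim w-free (z-stal W)

      w-stal₁ : σ₁ at w ≡ stal
      w-stal₁ = placed

      where-free₁ : ∀ {u} → σ₁ at u ≡ free → col u ≤ c ⊎ u ≡ s ⊎ u ≡ p
      where-free₁ {r , _} u-free₁ with unplace-free u-free₁
      ... | u≢w , u-free with where-free W u-free
      ...   | inj₂ e  = inj₂ e
      ...   | inj₁ lt with m≤n⇒m<n∨m≡n lt
      ...     | inj₁ (s≤s lt') = inj₁ lt'
      ...     | inj₂ refl with row-dichotomy (a≢b W) r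
      ...       | inj₁ refl = contradiction u-free (stal⇒unfree (z-stal W))
      ...       | inj₂ refl = contradiction refl u≢w

      column-stal : ∀ r → σ₁ at (r , suc c) ≡ stal
      column-stal r with row-dichotomy (a≢b W) r
      ... | inj₁ refl = z-stal₁
      ... | inj₂ refl = w-stal₁

      -- Dominator has replied `q`, and column `suc c` is all Staller's. When she takes `(e , c)`,
      -- only `(e , 2+ c)` can be free around `(e , suc c)`; it is not `q`, so `r` is forced.
      answer : ∀ {e f q r} → e ≢ f → q ≢ r → c < col q → c < col r →
               σ₁ at q ≡ free → σ₁ at r ≡ free →
               (∀ {u} → σ₁ at u ≡ free → col u ≤ c ⊎ u ≡ q ⊎ u ≡ r) →
               σ₁ at (e , 2+ c) ≢ dom → (e , 2+ c) ≢ q → Hits y b a f e c →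
               Stalls (suc c) (σ₁ [ q ≔ dominator ])
      answer {e} {f} {q} {r} e≢f q≢r c<q c<r q-free r-free where-f up-und up≢q h' =
        forced {t = e , suc c} (inside′ W , undom) only v-free r-free₂
          (col<⇒≢ c<r) (line c next h')
        where
        v : Cell
        v = e , c
        σ₂ σ₄ : Position
        σ₂ = σ₁ [ q ≔ dominator ]
        σ₄ = (σ₂ [ v ≔ staller ]) [ r ≔ dominator ]
        v-free : σ₂ at v ≡ free
        v-free = keep (col<⇒≢ c<q) (low-free (≢-sym (hits-misses (≢-sym e≢f) h')) ≤-refl)
        r-free₂ : σ₂ at r ≡ free
        r-free₂ = keep (≢-sym q≢r) r-free
        r-free₃ : (σ₂ [ v ≔ staller ]) at r ≡ free
        r-free₃ = keep (≢-sym (col<⇒≢ c<r)) r-free₂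
        column-stal₂ : ∀ row → σ₂ at (row , suc c) ≡ stal
        column-stal₂ row = keep-claim q-free (column-stal row)
        undom : ∀ {u} → u ∈N[ e , suc c ] → σ₂ at u ≢ dom
        undom self     = stal⇒undom (column-stal₂ _)
        undom (flip _) = stal⇒undom (column-stal₂ _)
        undom up       = keep-undom up≢q up-und
        undom down     = free⇒undom v-free
        only : ∀ {u} → u ∈N[ e , suc c ] → σ₂ at u ≡ free → u ≡ v ⊎ u ≡ r
        only self     u-free = contradiction u-free (stal⇒unfree (column-stal₂ _))
        only (flip _) u-free = contradiction u-free (stal⇒unfree (column-stal₂ _))
        only down     _      = inj₁ refl
        only up u-free with where-f (proj₂ (unplace-free u-free))
        ... | inj₁ lt         = contradiction lt (<⇒≱ (s≤s (n≤1+n c)))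
        ... | inj₂ (inj₁ u≡q) = contradiction u≡q up≢q
        ... | inj₂ (inj₂ u≡r) = inj₂ u≡r
        claim : ∀ {u A} → σ₁ at u ≡ just A → σ₄ at u ≡ just A
        claim = keep-claim r-free₃ ∘ keep-claim v-free ∘ keep-claim q-free
        low : ∀ {u} → u ≢ v → col u ≤ c → σ₁ at u ≡ free → σ₄ at u ≡ free
        low u≢v lt = keep (col<⇒≢ (≤-trans (s≤s lt) c<r)) ∘ keep u≢v ∘
                     keep (col<⇒≢ (≤-trans (s≤s lt) c<q))
        -- As both cells of column `suc c` are Staller's, the next threatened row may be `b` for
        -- either `e`: with `e` equal to `b` the line is straight in row `a`, with `e` equal to `a`
        -- it alternates.
        next : Line σ₄ c b a f e y
        next = record
          { inside     = ≤-trans (n≤1+n _) (inside′ W)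
          ; τ≢τ'       = b≢a
          ; ρ≢ρ'       = ≢-sym e≢f
          ; y-dom      = claim (keep-claim w-free (y-dom W))
          ; other-stal = keep-claim r-free₃ placed
          ; up-stal    = claim w-stal₁
          ; below-free = λ u≢y lt → low (col<⇒≢ lt) (<⇒≤ lt) (low-free u≢y (<⇒≤ lt))
          ; x-free     = λ y≢x → low (row≢⇒≢ (≢-sym e≢f)) ≤-refl (low-free (≢-sym y≢x) ≤-refl)
          ; where-free = locate
          }
          where
          locate : ∀ {u} → σ₄ at u ≡ free → col u < c ⊎ u ≡ (f , c)
          locate {row , _} u-free₄ with unplace-free u-free₄
          ... | u≢r , u-free₃ with unplace-free u-free₃
          ...   | u≢v , u-free₂ with unplace-free u-free₂
          ...     | u≢q , u-free₁ with where-f u-free₁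
          ...       | inj₂ (inj₁ u≡q) = contradiction u≡q u≢q
          ...       | inj₂ (inj₂ u≡r) = contradiction u≡r u≢r
          ...       | inj₁ lt with m≤n⇒m<n∨m≡n lt
          ...         | inj₁ lt' = inj₁ lt'
          ...         | inj₂ refl with row-dichotomy e≢f row
          ...           | inj₁ refl = contradiction refl u≢v
          ...           | inj₂ refl = inj₂ refl

      -- A reply `u` away from `s` and `p` loses: Staller takes `v`, which forces `x`, so
      -- `(e , 2+ c)` is hers too, and `(e , c)` completes the neighbourhood of `(e , suc c)`.
      punish : ∀ {u e v x} → σ₁ at u ≡ free → col u ≤ c → (e , c) ≢ u → σ₁ at (e , c) ≡ free →
               v ≢ x → c < col v → c < col x → σ₁ at v ≡ free → σ₁ at x ≡ free →
               (∀ {w} → w ∈N[ a , 2+ c ] → σ at w ≡ free → w ≡ v ⊎ w ≡ x) →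
               (∀ {w} → σ₁ at w ≡ free → col w ≤ c ⊎ w ≡ v ⊎ w ≡ x) →
               σ₁ at (e , 2+ c) ≢ dom → (e , 2+ c) ≢ x →
               Stalls (suc c) (σ₁ [ u ≔ dominator ])
      punish {u} {e} {v} {x} u-free u-low e≢u e-free v≢x c<v c<x v-free x-free only where-f up-und up≢x =
        forced {t = a , 2+ c} (inside W , λ w∈N → keep-undom (≢-sym (low≢ w∈N)) (proj₂ undom₁ w∈N))
          (λ w∈N → only w∈N ∘ proj₂ ∘ unplace-free ∘ proj₂ ∘ unplace-free) v-free₂ x-free₂ v≢x
          (staller-wins {t = e , suc c} (inside′ W)
            (keep (col<⇒≢ c<x) (keep (col<⇒≢ c<v) (keep e≢u e-free))) closed)
        where
        σ₂ σ₄ : Position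
        σ₂ = σ₁ [ u ≔ dominator ]
        σ₄ = (σ₂ [ v ≔ staller ]) [ x ≔ dominator ]
        low≢ : ∀ {w} → w ∈N[ a , 2+ c ] → u ≢ w
        low≢ w∈N = col<⇒≢ (≤-trans (s≤s u-low) (∈N-col w∈N))
        v-free₂ : σ₂ at v ≡ free
        v-free₂ = keep (≢-sym (col<⇒≢ (≤-trans (s≤s u-low) c<v))) v-free
        x-free₂ : σ₂ at x ≡ free
        x-free₂ = keep (≢-sym (col<⇒≢ (≤-trans (s≤s u-low) c<x))) x-free
        column : ∀ r → σ₄ at (r , suc c) ≡ stal
        column r = keep-claim (keep (≢-sym v≢x) x-free₂)
                     (keep-claim v-free₂ (keep-claim u-free (column-stal r)))
        up-claimed : σ₄ at (e , 2+ c) ≢ free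
        up-claimed f with unplace-free f
        ... | ≢x , f₃ with unplace-free f₃
        ...   | ≢v , f₂ with where-f (proj₂ (unplace-free f₂))
        ...     | inj₁ lt        = <⇒≱ (s≤s (n≤1+n c)) lt
        ...     | inj₂ (inj₁ ≡v) = ≢v ≡v
        ...     | inj₂ (inj₂ ≡x) = ≢x ≡x
        closed : ∀ {w} → w ∈N[ e , suc c ] → w ≢ (e , c) → σ₄ at w ≡ stal
        closed self     _  = column _
        closed (flip _) _  = column _
        closed down     ≢e = contradiction refl ≢e
        closed up       _  = settle (keep-undom up≢x (keep-undomˢ
          (keep-undom (≢-sym (col<⇒≢ (s≤s (m≤n⇒m≤1+n u-low)))) up-und))) up-claimed

      a-undom₁ : σ₁ at (a , 2+ c) ≢ dom
      a-undom₁ = keep-undomˢ (a-undom W)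

      b-undom₁ : σ₁ at (b , 2+ c) ≢ dom
      b-undom₁ = keep-undomˢ (b-undom W)

      reply : ∀ {u} → σ₁ at u ≡ free → Stalls (suc c) (σ₁ [ u ≔ dominator ])
      reply {u} u-free with where-free₁ u-free
      ... | inj₂ (inj₁ refl) = answer b≢a (s≢p W) s>c p>c s-free₁ p-free₁
              where-free₁ b-undom₁ (b≢s W) (hits-straight c i≤c)
      ... | inj₂ (inj₂ refl) = answer (a≢b W) (≢-sym (s≢p W)) p>c s>c p-free₁ s-free₁
              (map₂ swap ∘ where-free₁) a-undom₁ (a≢p W) h
      -- The final blow falls in row `a`, unless Dominator has just taken its cell `az`; then it
      -- falls in row `b`, with `s` and `p` exchanged.
      ... | inj₁ lt with az ≟ u
      ...   | no az≢u  = punish u-free lt az≢u az-free (s≢p W) s>c p>c s-free₁ p-free₁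
              (only-s-p W) where-free₁ a-undom₁ (a≢p W)
      ...   | yes refl = punish u-free lt (row≢⇒≢ b≢a) bz-free (≢-sym (s≢p W)) p>c s>c p-free₁ s-free₁
              (λ w∈N → swap ∘ only-s-p W w∈N) (map₂ swap ∘ where-free₁) b-undom₁ (b≢s W)

-- The initial position and the lower bound

-- Columns ≥ n count as claimed by Staller, so the last column needs no special treatment.
start : ℕ → Position
start n (_ , c) = if does (c <? n) then free else stal

start-free : ∀ {n u} → col u < n → start n at u ≡ free
start-free {n} {u} lt = trans (at-def {start n} {u}) eq
  where
  eq : start n u ≡ free
  eq rewrite dec-true (col u <? n) lt = refl

start-wall : ∀ {n u} → ¬ col u < n → start n at u ≡ stal
start-wall {n} {u} ≮ = trans (at-def {start n} {u}) eq
  where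
  eq : start n u ≡ stal
  eq rewrite dec-false (col u <? n) ≮ = refl

start-inside : ∀ {n u} → start n at u ≡ free → col u < n
start-inside {n} {u} u-free with col u <? n
... | yes lt = lt
... | no  ≮  = contradiction u-free (stal⇒unfree (start-wall ≮))

module _ (m : ℕ) where

  open Staller (suc m)
  open Strategy (suc m)

  start-represents : Represents (start (suc m)) (Game.∅ (P 2 □ P (suc m))) (Game.∅ (P 2 □ P (suc m)))
  start-represents = record
    { D⇒dom  = λ ()
    ; dom⇒D  = λ {v} v-dom → free⇒undom (start-free (toℕ<n (proj₂ v))) v-dom
    ; S⇒stal = λ ()
    ; stal⇒S = λ {v} v-stal → stal⇒unfree v-stal (start-free (toℕ<n (proj₂ v)))
    ; free⇒< = start-inside
    }

  -- The empty board is a front at the last column: `s` and `p` are its two cells, and the cell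
  -- beyond the end counts as Staller's.
  start-front : Front (start (suc m)) m zero (suc zero) (zero , m) (suc zero , m)
  start-front = record
    { inside     = ≤-refl
    ; a≢b        = λ ()
    ; below-free = start-free ∘ m≤n⇒m≤1+n
    ; s-free     = start-free ≤-refl
    ; p-free     = start-free ≤-refl
    ; s≢p        = λ ()
    ; s-col      = ≤-refl
    ; p-col      = ≤-refl
    ; where-free = locate
    ; a-undom    = free⇒undom (start-free ≤-refl)
    ; b-undom    = free⇒undom (start-free ≤-refl)
    ; up-undom   = stal⇒undom (start-wall (<-irrefl refl))
    ; a≢p        = λ ()
    ; b≢s        = λ ()
    }
    where
    locate : ∀ {u} → start (suc m) at u ≡ free → col u < m ⊎ u ≡ (zero , m) ⊎ u ≡ (suc zero , m)
    locate {r , _} u-free with start-inside {suc m} u-free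
    ... | s≤s lt with m≤n⇒m<n∨m≡n lt
    ...   | inj₁ lt' = inj₁ lt'
    locate {zero     , _} _ | _ | inj₂ refl = inj₂ (inj₁ refl)
    locate {suc zero , _} _ | _ | inj₂ refl = inj₂ (inj₂ refl)

  lower-bound : ∀ k → k < suc m → ¬ Game.WinsSGameWithin (P 2 □ P (suc m)) k
  lower-bound _ k<n = front m start-front k<n start-represents

-- The pairing strategy and the upper bound

-- Removing `x` a second time changes nothing, whereas removing a member would lower the
-- cardinality.
x∉p-x : ∀ {n} {p : Subset n} {x} → x ∉ p - x
x∉p-x {p = p} {x} x∈ =
  <-irrefl (cong ∣_∣ (p─q─q≡p─q p ⁅ x ⁆)) (x∈p⇒∣p-x∣<∣p∣ x∈)

module Pairing (n : ℕ) where

  open Game (P 2 □ P n)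

  mate : V → V
  mate (r , i) = opposite r , i

  mate-involutive : ∀ v → mate (mate v) ≡ v
  mate-involutive (r , i) = cong (_, i) (opposite-involutive r)

  mate-∼ : ∀ v → v ∼ mate v
  mate-∼ (zero     , i) = inj₂ (inj₂ refl , refl)
  mate-∼ (suc zero , i) = inj₂ (inj₁ refl , refl)

  mate-≢ : ∀ v → mate v ≢ v
  mate-≢ (zero     , i) ()
  mate-≢ (suc zero , i) ()

  same-column : ∀ u v → proj₂ u ≡ proj₂ v → u ≡ v ⊎ u ≡ mate v
  same-column (zero     , i) (zero     , i) refl = inj₁ refl
  same-column (zero     , i) (suc zero , i) refl = inj₂ refl
  same-column (suc zero , i) (zero     , i) refl = inj₂ refl
  same-column (suc zero , i) (suc zero , i) refl = inj₁ refl

  -- `Open` consists of the columns not yet played in. Its size bounds the moves Dominator still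
  -- needs, and its decidable membership makes up for `D` and `S` being arbitrary predicates.
  record Paired (Open : Subset n) (D S : VSet (P 2 □ P n)) : Set where
    field
      unclaimed : ∀ {v} → proj₂ v ∈ Open → Unclaimed D S v
      claimed   : ∀ {v} → proj₂ v ∉ Open → D v ⊎ S v
      answered  : ∀ {v} → S v → D (mate v)
      disjoint  : ∀ {v} → D v → ¬ S v

  open Paired

  -- Replying with the mate closes one column per move. When none is open, each vertex is
  -- Dominator's or has its mate among his.
  paired-wins : ∀ {Open D S} k → ∣ Open ∣ ≤ k → Paired Open D S → WinS k D S
  paired-wins {Open} {D} {S} zero ≤0 Q = inj₁ dominating
    where
    dominating : Dominating D
    dominating v with claimed Q {v} (λ i∈ → <⇒≱ (x∈p⇒∣p-x∣<∣p∣ i∈) (≤-trans ≤0 z≤n))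
    ... | inj₁ d = inj₁ d
    ... | inj₂ s = inj₂ (mate v , mate-∼ v , answered Q s)
  paired-wins {Open} {D} {S} (suc k) ≤k Q = inj₂ respond
    where
    respond : ∀ v → Unclaimed D S v →
              ¬ StallerWon (_⊕_ {P 2 □ P n} S v) × WinD (suc k) D (_⊕_ {P 2 □ P n} S v)
    respond v@(_ , i) (v∉D , v∉S) =
      safe ,
      inj₂ (mate v ,
            (proj₁ mate-free , λ { (inj₁ s) → proj₂ mate-free s ; (inj₂ e) → mate-≢ v e }) ,
            paired-wins k (s≤s⁻¹ (≤-trans (x∈p⇒∣p-x∣<∣p∣ i∈) ≤k)) next)
      where
      i∈ : i ∈ Open
      i∈ = decidable-stable (i ∈? Open) (λ i∉ → [ v∉D , v∉S ]′ (claimed Q i∉))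

      mate-free : Unclaimed D S (mate v)
      mate-free = unclaimed Q i∈

      safe : ¬ StallerWon (_⊕_ {P 2 □ P n} S v)
      -- A closed neighbourhood contains a vertex and its mate. Earlier Staller vertices have mates
      -- owned by Dominator, and the mate of the new `v` is not hers.
      safe (t , t∈ , N⊆) with t∈ | N⊆ (mate t) (mate-∼ t)
      ... | inj₁ t∈S  | inj₁ t'∈S = disjoint Q (answered Q t∈S) t'∈S
      ... | inj₁ t∈S  | inj₂ refl = v∉D (answered Q t∈S)
      ... | inj₂ refl | inj₁ t'∈S = v∉D (subst D (mate-involutive v) (answered Q t'∈S))
      ... | inj₂ refl | inj₂ e    = mate-≢ v e

      next : Paired (Open - i) (_⊕_ {P 2 □ P n} D (mate v)) (_⊕_ {P 2 □ P n} S v)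
      next = record
        { unclaimed = λ {u} u∈ →
            [ proj₁ (unclaimed Q (p─q⊆p Open ⁅ i ⁆ u∈)) , (λ { refl → x∉p-x u∈ }) ]′ ,
            [ proj₂ (unclaimed Q (p─q⊆p Open ⁅ i ⁆ u∈)) , (λ { refl → x∉p-x u∈ }) ]′
        ; claimed   = claimed′
        ; answered  = λ { (inj₁ s) → inj₁ (answered Q s) ; (inj₂ refl) → inj₂ refl }
        ; disjoint  = λ { (inj₁ d)    (inj₁ s)    → disjoint Q d s
                        ; (inj₁ d)    (inj₂ refl) → v∉D d
                        ; (inj₂ refl) (inj₁ s)    → proj₂ mate-free s
                        ; (inj₂ refl) (inj₂ e)    → mate-≢ v e }
        }
        where
        claimed′ : ∀ {u} → proj₂ u ∉ Open - i → (D u ⊎ u ≡ mate v) ⊎ (S u ⊎ u ≡ v)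
        claimed′ {u} u∉ with proj₂ u Fin.≟ i
        ... | no  j≢i = map inj₁ inj₁ (claimed Q (λ j∈ → u∉ (x∈p∧x≢y⇒x∈p-y j∈ j≢i)))
        ... | yes j≡i with same-column u v j≡i
        ...   | inj₁ u≡v  = inj₂ (inj₂ u≡v)
        ...   | inj₂ u≡v' = inj₁ (inj₂ u≡v')

  upper-bound : WinsSGameWithin n
  upper-bound = paired-wins n (≤-reflexive (∣⊤∣≡n n)) record
    { unclaimed = λ _ → (λ ()) , (λ ())
    ; claimed   = λ i∉ → contradiction ∈⊤ i∉
    ; answered  = λ ()
    ; disjoint  = λ ()
    }

theorem4 : ∀ (n : ℕ) → n ≥ 1 → γ'MB≡ (P 2 □ P n) n
theorem4 (suc m) _ = Pairing.upper-bound (suc m) , lower-bound m
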